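{- If $n = 12m$ with $m \geq 1$ an integer, then the circulant graph $C(n,\{1,2,3\})$ is nearly dispersable.
   Context: All graphs are finite and simple. For a set $S=\{i_1<\cdots<i_k\}$ of integers with $k\ge 1$, $1\le i_1$ and $i_k\le \lfloor n/2\rfloor$, the circulant $C(n,S)$ is the graph on vertex set $\{1,\ldots,n\}$ in which each $j$ is adjacent to $j+i_r$ (addition mod $n$) for $r=1,\ldots,k$. Given a graph $G$ and a cyclic order $\omega$ on $V(G)$, draw the vertices on a circle in the order $\omega$ and the edges as straight chords; two edges cross if they intersect at a point that is not an endpoint. A matching book embedding $(G,\omega,c)$ consists of $G$, a cyclic order $\omega$, and an edge-coloring $c$ (the color classes are the pages) such that any two distinct edges of the same color neither cross nor share an endpoint. The embedding is dispersable if the number of colors equals the maximum degree $\Delta(G)$, and nearly dispersable if the number of colors equals $1+\Delta(G)$. A graph is dispersable if it has a dispersable matching book embedding; it is nearly dispersable if it is not dispersable and has a nearly dispersable matching book embedding. -}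

module Defs where

open import Data.Fin.Base using (Fin; toℕ; _<_)
open import Data.Fin.Permutation using (Permutation′; _⟨$⟩ʳ_)
open import Data.Fin.Properties using (toℕ<n; nonZeroIndex)
open import Data.List.Base using (List; []; _∷_; allFin; filter; length; map)
open import Data.List.Extrema.Nat using (max)
open import Data.List.Membership.Propositional using (find)
open import Data.List.Relation.Unary.All as All using (All; []; _∷_)
open import Data.List.Relation.Unary.Any as Any using (Any; any?)
open import Data.List.Relation.Unary.Linked using (Linked; [-]; _∷_)
open import Data.Nat.Base as ℕ using (ℕ; suc; _+_; _*_; _∸_; _≤_; _≥_; ⌊_/2⌋; NonZero; z≤n; s≤s)
open import Data.Nat.DivMod using (_%_; m<n⇒m%n≡m; m≤n⇒[n∸m]%m≡n%m)
import Data.Nat.Properties as ℕ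
open import Data.Product.Base using (_×_; _,_)
open import Data.Sum.Base using (_⊎_; inj₁; inj₂; [_,_]; swap)
open import Function.Definitions using (Surjective)
open import Level using (0ℓ)
open import Relation.Binary.Core using (Rel)
open import Relation.Binary.Definitions using (Decidable; Irreflexive; Symmetric)
open import Relation.Binary.PropositionalEquality using (_≡_; _≢_; refl; sym; trans; cong; subst)
open import Relation.Nullary using (¬_; yes; no)
open import Relation.Nullary.Decidable using (_⊎-dec_)

record Graph (n : ℕ) : Set₁ where
  field
    Adj         : Rel (Fin n) 0ℓ
    adj?        : Decidable Adj
    symmetric   : Symmetric Adj
    irreflexive : Irreflexive _≡_ Adj

module _ {n : ℕ} (G : Graph n) where
  open Graph G

  degree : Fin n → ℕ
  degree v = length (filter (adj? v) (allFin n))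

  maxDegree : ℕ
  maxDegree = max 0 (map degree (allFin n))

  -- The unordered pair {u , v} is represented by its increasing enumeration.
  -- The proofs are irrelevant, so edges are equal as soon as their endpoints
  -- are.
  record Edge : Set where
    constructor edge
    field
      source target : Fin n
      .source<target : source < target
      .adjacent      : Adj source target

module _ {n : ℕ} where

  -- Going round the circle from a, one meets b before c (all distinct).
  Cyclic : Fin n → Fin n → Fin n → Set
  Cyclic a b c = (a < b × b < c) ⊎ (b < c × c < a) ⊎ (c < a × a < b)

  -- Distinct straight chords ab and cd of a circle meet at a point that is not
  -- an endpoint exactly when c and d lie in different open arcs cut off by a
  -- and b.
  ChordsCross : (a b c d : Fin n) → Set
  ChordsCross a b c d =
    (Cyclic a c b × Cyclic b d a) ⊎ (Cyclic a d b × Cyclic b c a)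

module _ {n : ℕ} {G : Graph n} where
  open Edge

  Crosses : Permutation′ n → Edge G → Edge G → Set
  Crosses ω e f =
    ChordsCross (ω ⟨$⟩ʳ source e) (ω ⟨$⟩ʳ target e)
                (ω ⟨$⟩ʳ source f) (ω ⟨$⟩ʳ target f)

  ShareEndpoint : Edge G → Edge G → Set
  ShareEndpoint e f =
    (source e ≡ source f ⊎ source e ≡ target f) ⊎
    (target e ≡ source f ⊎ target e ≡ target f)

-- A cyclic order is given by the position of each vertex among n consecutive
-- points of the circle; crossing depends on it only up to rotation.
-- Surjectivity of the colouring makes k the number of colours actually used.
record MatchingBookEmbedding {n : ℕ} (G : Graph n) (k : ℕ) : Set where
  field
    order             : Permutation′ n
    colour            : Edge G → Fin k
    colour-surjective : Surjective _≡_ _≡_ colour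
    noncrossing       : ∀ e f → e ≢ f → colour e ≡ colour f → ¬ Crosses order e f
    matching          : ∀ e f → e ≢ f → colour e ≡ colour f → ¬ ShareEndpoint e f

Dispersable : ∀ {n} → Graph n → Set
Dispersable G = MatchingBookEmbedding G (maxDegree G)

NearlyDispersable : ∀ {n} → Graph n → Set
NearlyDispersable G = ¬ Dispersable G × MatchingBookEmbedding G (1 + maxDegree G)

-- A set {i₁ < ⋯ < iₖ} is represented by the list i₁ ∷ ⋯ ∷ iₖ ∷ [].
record IsConnectionSet (n : ℕ) (S : List ℕ) : Set where
  field
    nonEmpty   : S ≢ []
    increasing : Linked ℕ._<_ S
    bounded    : All (λ i → 1 ≤ i × i ≤ ⌊ n /2⌋) S

-- v = u + i modulo n.  The residue 0 plays the role of the vertex n.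
Step : ∀ {n} → ℕ → Rel (Fin n) 0ℓ
Step {n} i u v = toℕ v ≡ (toℕ u + i) % n
  where instance _ = nonZeroIndex u

step? : ∀ {n} i → Decidable (Step {n} i)
step? i u v = toℕ v ℕ.≟ _

CirculantAdj : ∀ n → List ℕ → Rel (Fin n) 0ℓ
CirculantAdj n S u v = Any (λ i → Step i u v ⊎ Step i v u) S

private
  ⌊n/2⌋<n : ∀ n → .{{NonZero n}} → ⌊ n /2⌋ ℕ.< n
  ⌊n/2⌋<n (suc n) = ℕ.⌊n/2⌋<n n

  [m+i]%n≢m : ∀ {m n i} .{{_ : NonZero n}} → m ℕ.< n → 1 ≤ i → i ℕ.< n →
              m ≢ (m + i) % n
  [m+i]%n≢m {m} {n} {i} m<n 1≤i i<n eq with (m + i) ℕ.<? n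
  ... | yes m+i<n =
    ℕ.m+1+n≢m m {ℕ.pred i} (trans (cong (m +_) (ℕ.suc-pred i {{ℕ.>-nonZero 1≤i}}))
      (sym (trans eq (m<n⇒m%n≡m m+i<n))))
  ... | no  m+i≮n = ℕ.<-irrefl (sym m≡m+i∸n) m+i∸n<m
    where
    n≤m+i = ℕ.≮⇒≥ m+i≮n

    m+i∸n<m : m + i ∸ n ℕ.< m
    m+i∸n<m = ℕ.+-cancelʳ-< n (m + i ∸ n) m
      (subst (ℕ._< m + n) (sym (ℕ.m∸n+n≡m n≤m+i)) (ℕ.+-monoʳ-< m i<n))

    m≡m+i∸n : m ≡ m + i ∸ n
    m≡m+i∸n = trans eq (trans (sym (m≤n⇒[n∸m]%m≡n%m n≤m+i))
      (m<n⇒m%n≡m (ℕ.<-trans m+i∸n<m m<n)))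

circulant : ∀ n S → IsConnectionSet n S → Graph n
circulant n S isS = record
  { Adj         = CirculantAdj n S
  ; adj?        = λ u v → any? (λ i → step? i u v ⊎-dec step? i v u) S
  ; symmetric   = Any.map swap
  ; irreflexive = λ { {u} refl → irr u }
  }
  where
  irr : ∀ u → ¬ CirculantAdj n S u u
  irr u adj with find adj
  ... | i , i∈S , step with All.lookup (IsConnectionSet.bounded isS) i∈S
  ...   | 1≤i , i≤n/2 = [ absurd , absurd ] step
    where
    instance _ = nonZeroIndex u
    absurd = [m+i]%n≢m (toℕ<n u) 1≤i (ℕ.≤-<-trans i≤n/2 (⌊n/2⌋<n n))

isConnectionSet₁₂₃ : ∀ {n} → 6 ≤ n → IsConnectionSet n (1 ∷ 2 ∷ 3 ∷ [])
isConnectionSet₁₂₃ {n} 6≤n = record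
  { nonEmpty   = λ ()
  ; increasing = ℕ.n<1+n 1 ∷ ℕ.n<1+n 2 ∷ [-]
  ; bounded    = (s≤s z≤n , ℕ.≤-trans (ℕ.m≤m+n 1 2) 3≤n/2)
               ∷ (s≤s z≤n , ℕ.≤-trans (ℕ.m≤m+n 2 1) 3≤n/2)
               ∷ (s≤s z≤n , 3≤n/2)
               ∷ []
  }
  where
  3≤n/2 : 3 ≤ ⌊ n /2⌋
  3≤n/2 = ℕ.⌊n/2⌋-mono 6≤n

6≤12*m : ∀ {m} → m ≥ 1 → 6 ≤ 12 * m
6≤12*m m≥1 = ℕ.≤-trans (ℕ.m≤m+n 6 6) (ℕ.*-monoʳ-≤ 12 m≥1)

{-# OPTIONS --safe #-}

-- Let k pages suffice for a k-regular graph.  Every vertex then meets every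
-- page, so a page is a noncrossing perfect matching, and the vertices strictly
-- between two matched positions are matched among themselves.  Their number is
-- even, so positions of adjacent vertices have opposite parity and the graph is
-- bipartite.  The 6-regular graph C(n,{1,2,3}) contains triangles.
--
-- Conversely, keep the natural order and cut the circle into consecutive blocks
-- of four (in four ways) or of three (in three ways).  A block {i,…,i+3}
-- contributes the nested edges {i,i+3} and {i+1,i+2}, a block {i,i+1,i+2} the
-- edge {i,i+2}.  These seven pages contain each edge exactly once.
module Submission where

open import Defs
open import Data.Fin.Base as Fin using (Fin; toℕ; fromℕ<; join; punchOut; splitAt)
open import Data.Fin.Permutation as Perm
  using (Permutation′; _⟨$⟩ʳ_; _⟨$⟩ˡ_; inverseˡ; inverseʳ)
import Data.Fin.Properties as Fin
open import Data.List.Base as List using (List; []; _∷_; allFin; filter; length; map)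
open import Data.List.Extrema.Nat using (max≤v⁺; v≤max⁺)
open import Data.List.Membership.Propositional using (_∈_; find; lose)
open import Data.List.Membership.Propositional.Properties
  using (∈-filter⁺; ∈-filter⁻; ∈-lookup; ∈-allFin; ∈-map⁺)
open import Data.List.Membership.Propositional.Properties.WithK using (unique∧set⇒bag)
open import Data.List.Relation.Binary.BagAndSetEquality using (∼bag⇒↭)
open import Data.List.Relation.Binary.Permutation.Propositional.Properties using (↭-length)
import Data.List.Relation.Unary.All as All
import Data.List.Relation.Unary.All.Properties as All
open import Data.List.Relation.Unary.AllPairs as AllPairs using (AllPairs; _∷_)
import Data.List.Relation.Unary.AllPairs.Properties as AllPairs
open import Data.List.Relation.Unary.Any using (here; there)
open import Data.List.Relation.Unary.Linked using ([-]; _∷_)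
open import Data.List.Relation.Unary.Linked.Properties using (Linked⇒AllPairs)
open import Data.List.Relation.Unary.Unique.Propositional using (Unique)
import Data.List.Relation.Unary.Unique.Propositional.Properties as Unique
open import Data.Nat.Base
  using (ℕ; zero; suc; _+_; _*_; _∸_; _≤_; _<_; _≥_; NonZero; >-nonZero; z≤n; z<s; s≤s; parity)
open import Data.Nat.DivMod
open import Data.Nat.Divisibility using (_∣_; divides; m∣m*n; ∣-refl; ∣-trans)
open import Data.Nat.Properties
open import Data.Parity.Base using (Parity; 0ℙ; 1ℙ; _⁻¹)
import Data.Parity.Properties as ℙ
open import Data.Product.Base using (∃; ∃₂; _×_; _,_; proj₁; proj₂; swap)
open import Data.Sum.Base as Sum using (_⊎_; inj₁; inj₂; [_,_]′)
open import Function.Base using (_∘_; id)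
open import Function.Bundles using (mk⇔)
open import Function.Definitions using (Injective)
open import Level using (0ℓ)
open import Relation.Binary.Core using (Rel)
open import Relation.Binary.Definitions using (Symmetric; tri<; tri≈; tri>)
open import Relation.Binary.PropositionalEquality
open import Relation.Nullary using (¬_; yes; no; contradiction; recompute)

-- Counting in finite sets and duplicate-free lists.

-- A missed value `y` could be punched out of the codomain, leaving an injection into a set with one
-- element fewer. The sizes are related by an equation because `m` will be a degree that equals `n`
-- only propositionally.
injective⇒surjective : ∀ {m n} → m ≡ n → (f : Fin m → Fin n) → Injective _≡_ _≡_ f →
                       ∀ y → ∃ λ x → f x ≡ y
injective⇒surjective {suc n} refl f inj y with Fin.any? (λ x → f x Fin.≟ y)
... | yes hit = hit
... | no  ¬hit = contradiction (Fin.injective⇒≤ punched-injective) 1+n≰n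
  where
  y≢f : ∀ x → y ≢ f x
  y≢f x y≡fx = ¬hit (x , sym y≡fx)

  punched-injective : Injective _≡_ _≡_ (λ x → punchOut (y≢f x))
  punched-injective {i} {j} = inj ∘ Fin.punchOut-injective (y≢f i) (y≢f j)

lookup-injective : ∀ {A : Set} {xs : List A} → Unique xs →
                   ∀ i j → List.lookup xs i ≡ List.lookup xs j → i ≡ j
lookup-injective (_  ∷ _)   Fin.zero    Fin.zero    _  = refl
lookup-injective (x∉ ∷ _)   Fin.zero    (Fin.suc j) eq =
  contradiction eq (All.lookup x∉ (∈-lookup j))
lookup-injective (x∉ ∷ _)   (Fin.suc i) Fin.zero    eq =
  contradiction (sym eq) (All.lookup x∉ (∈-lookup i))
lookup-injective (_  ∷ xs!) (Fin.suc i) (Fin.suc j) eq = cong Fin.suc (lookup-injective xs! i j eq)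

-- Edges as unordered pairs of endpoints.

chordsCross-swapˡ : ∀ {n} {a b c d : Fin n} → ChordsCross a b c d → ChordsCross b a c d
chordsCross-swapˡ = [ inj₂ ∘ swap , inj₁ ∘ swap ]′

module _ {n : ℕ} {G : Graph n} where
  open Graph G
  open Edge

  source<target′ : (e : Edge G) → source e Fin.< target e
  source<target′ (edge s t s<t _) = recompute (s Fin.<? t) s<t

  -- An edge stores its endpoints in increasing order; `Joins` forgets this order, so that an edge
  -- can be read from either end.
  Joins : Edge G → Fin n → Fin n → Set
  Joins e u v = (source e ≡ u × target e ≡ v) ⊎ (source e ≡ v × target e ≡ u)

  joins-sym : ∀ {e u v} → Joins e u v → Joins e v u
  joins-sym = Sum.swap

  edgeBetween : ∀ {u v} → Adj u v → ∃ λ e → Joins e u v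
  edgeBetween {u} {v} uv with Fin.<-cmp u v
  ... | tri< u<v _   _   = edge u v u<v uv , inj₁ (refl , refl)
  ... | tri≈ _   u≡v _   = contradiction uv (irreflexive u≡v)
  ... | tri> _   _   v<u = edge v u v<u (symmetric uv) , inj₂ (refl , refl)

  joins-irrefl : ∀ {e u v} → Joins e u v → u ≢ v
  joins-irrefl {e} (inj₁ (refl , refl)) = Fin.<⇒≢ (source<target′ e)
  joins-irrefl {e} (inj₂ (refl , refl)) = ≢-sym (Fin.<⇒≢ (source<target′ e))

  joins-functional : ∀ {e f u v w} → e ≡ f → Joins e u v → Joins f u w → v ≡ w
  joins-functional {e} refl (inj₁ (refl , refl)) (inj₁ (_ , refl)) = refl
  joins-functional {e} refl (inj₂ (refl , refl)) (inj₂ (refl , _)) = refl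
  joins-functional {e} refl euv@(inj₁ (refl , refl)) (inj₂ (_ , t≡s)) =
    contradiction (sym t≡s) (joins-irrefl {e} euv)
  joins-functional {e} refl euv@(inj₂ (refl , refl)) (inj₁ (s≡t , _)) =
    contradiction (sym s≡t) (joins-irrefl {e} euv)

  joins-endpoint : ∀ {e f x y u v} → e ≡ f → Joins e x y → Joins f u v → u ≡ x ⊎ u ≡ y
  joins-endpoint refl (inj₁ (refl , refl)) (inj₁ (refl , _)) = inj₁ refl
  joins-endpoint refl (inj₁ (refl , refl)) (inj₂ (_ , refl)) = inj₂ refl
  joins-endpoint refl (inj₂ (refl , refl)) (inj₁ (refl , _)) = inj₂ refl
  joins-endpoint refl (inj₂ (refl , refl)) (inj₂ (_ , refl)) = inj₁ refl

  joins⇒share : ∀ {e f u v w} → Joins e u v → Joins f u w → ShareEndpoint e f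
  joins⇒share (inj₁ (p , _)) (inj₁ (q , _)) = inj₁ (inj₁ (trans p (sym q)))
  joins⇒share (inj₁ (p , _)) (inj₂ (_ , q)) = inj₁ (inj₂ (trans p (sym q)))
  joins⇒share (inj₂ (_ , p)) (inj₁ (q , _)) = inj₂ (inj₁ (trans p (sym q)))
  joins⇒share (inj₂ (_ , p)) (inj₂ (_ , q)) = inj₂ (inj₂ (trans p (sym q)))

  share⇒joins : ∀ {e f u v x y} → Joins e u v → Joins f x y → ShareEndpoint e f →
                (u ≡ x ⊎ u ≡ y) ⊎ (v ≡ x ⊎ v ≡ y)
  share⇒joins (inj₁ (refl , refl)) (inj₁ (refl , refl)) = id
  share⇒joins (inj₁ (refl , refl)) (inj₂ (refl , refl)) = Sum.map Sum.swap Sum.swap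
  share⇒joins (inj₂ (refl , refl)) (inj₁ (refl , refl)) = Sum.swap
  share⇒joins (inj₂ (refl , refl)) (inj₂ (refl , refl)) = Sum.swap ∘ Sum.map Sum.swap Sum.swap

  module _ (ω : Permutation′ n) where

    crosses⇒chordsCross : ∀ {e f u v x y} → Joins e u v → Joins f x y → Crosses ω e f →
                          ChordsCross (ω ⟨$⟩ʳ u) (ω ⟨$⟩ʳ v) (ω ⟨$⟩ʳ x) (ω ⟨$⟩ʳ y)
    crosses⇒chordsCross (inj₁ (refl , refl)) (inj₁ (refl , refl)) = id
    crosses⇒chordsCross (inj₁ (refl , refl)) (inj₂ (refl , refl)) = Sum.swap
    crosses⇒chordsCross (inj₂ (refl , refl)) (inj₁ (refl , refl)) = chordsCross-swapˡ
    crosses⇒chordsCross (inj₂ (refl , refl)) (inj₂ (refl , refl)) = chordsCross-swapˡ ∘ Sum.swap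

    chordsCross⇒crosses : ∀ {e f u v x y} → Joins e u v → Joins f x y →
                          ChordsCross (ω ⟨$⟩ʳ u) (ω ⟨$⟩ʳ v) (ω ⟨$⟩ʳ x) (ω ⟨$⟩ʳ y) → Crosses ω e f
    chordsCross⇒crosses (inj₁ (refl , refl)) (inj₁ (refl , refl)) = id
    chordsCross⇒crosses (inj₁ (refl , refl)) (inj₂ (refl , refl)) = Sum.swap
    chordsCross⇒crosses (inj₂ (refl , refl)) (inj₁ (refl , refl)) = chordsCross-swapˡ
    chordsCross⇒crosses (inj₂ (refl , refl)) (inj₂ (refl , refl)) = chordsCross-swapˡ ∘ Sum.swap

-- Parity in noncrossing perfect matchings.

p≢p⁻¹ : ∀ p → p ≢ p ⁻¹
p≢p⁻¹ 0ℙ ()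
p≢p⁻¹ 1ℙ ()

no-three-parities : ∀ {p q r : Parity} → p ≢ q → q ≢ r → p ≢ r → ∀ {A : Set} → A
no-three-parities {0ℙ} {0ℙ} {_}  p≢q _   _   = contradiction refl p≢q
no-three-parities {1ℙ} {1ℙ} {_}  p≢q _   _   = contradiction refl p≢q
no-three-parities {_}  {0ℙ} {0ℙ} _   q≢r _   = contradiction refl q≢r
no-three-parities {_}  {1ℙ} {1ℙ} _   q≢r _   = contradiction refl q≢r
no-three-parities {0ℙ} {_}  {0ℙ} _   _   p≢r = contradiction refl p≢r
no-three-parities {1ℙ} {_}  {1ℙ} _   _   p≢r = contradiction refl p≢r

module NoncrossingPerfectMatching {n : ℕ} (M : Rel (Fin n) 0ℓ)
  (total       : ∀ x → ∃ (M x))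
  (symm        : Symmetric M)
  (irrefl      : ∀ {x y} → M x y → x ≢ y)
  (functional  : ∀ {x y z} → M x y → M x z → y ≡ z)
  (noncrossing : ∀ {x y u v} → M x y → M u v → x Fin.< u → u Fin.< y →
                 ¬ v Fin.< x × ¬ y Fin.< v)
  where

  -- The interval is half-open, so `parity lo ≡ parity hi` expresses that it has an even number of
  -- positions.
  Closed : ℕ → ℕ → Set
  Closed lo hi = ∀ {u v} → M u v → lo ≤ toℕ u → toℕ u < hi → lo ≤ toℕ v × toℕ v < hi

  -- The hypothesis `noncrossing` excludes partners strictly outside; a partner equal to `x` or `y`
  -- is excluded because these two are matched to each other.
  inside-closed : ∀ {x y} → M x y → Closed (suc (toℕ x)) (toℕ y)
  inside-closed xy uv x<u u<y with noncrossing xy uv x<u u<y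
  ... | v≮x , y≮v =
    ≤∧≢⇒< (≮⇒≥ v≮x) (λ x≡v → Fin.<⇒≢ u<y
      (functional (subst (λ z → M z _) (sym (Fin.toℕ-injective x≡v)) (symm uv)) xy)) ,
    ≤∧≢⇒< (≮⇒≥ y≮v) (λ v≡y → Fin.<⇒≢ x<u
      (functional (symm xy) (subst (λ z → M z _) (Fin.toℕ-injective v≡y) (symm uv))))

  -- The partner `v` of `u` cannot lie strictly between `x` and `y`, since `inside-closed` would
  -- then put `u` there as well; nor can it be `x` or `y`, whose partners are already known.
  after-closed : ∀ {x y hi} → M x y → toℕ x < toℕ y → Closed (toℕ x) hi → Closed (suc (toℕ y)) hi
  after-closed {x} {y} xy x<y closed {u} {v} uv y<u u<hi
    with closed uv (<⇒≤ (<-trans x<y y<u)) u<hi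
  ... | x≤v , v<hi with Fin.<-cmp v y
  ...   | tri> _ _ y<v = y<v , v<hi
  ...   | tri≈ _ refl _ = contradiction (functional (symm xy) (symm uv)) (Fin.<⇒≢ (<-trans x<y y<u))
  ...   | tri< v<y _ _ with m≤n⇒m<n∨m≡n x≤v
  ...     | inj₁ x<v = contradiction (proj₂ (inside-closed xy (symm uv) x<v v<y)) (<⇒≯ y<u)
  ...     | inj₂ x≡v with refl ← Fin.toℕ-injective x≡v =
    contradiction (functional xy (symm uv)) (Fin.<⇒≢ y<u)

  -- The number k only bounds the length of the interval.
  closed⇒parity≡ : ∀ k {lo hi} → lo ≤ hi → hi ≤ n → hi ≤ lo + k → Closed lo hi →
                   parity lo ≡ parity hi
  closed⇒parity≡ zero    {lo} lo≤hi _ hi≤lo+0 _ =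
    cong parity (≤-antisym lo≤hi (subst (_ ≤_) (+-identityʳ lo) hi≤lo+0))
  closed⇒parity≡ (suc k) {lo} {hi} lo≤hi hi≤n hi≤lo+1+k closed with m≤n⇒m<n∨m≡n lo≤hi
  ... | inj₂ lo≡hi = cong parity lo≡hi
  ... | inj₁ lo<hi with fromℕ< (≤-trans lo<hi hi≤n) | Fin.toℕ-fromℕ< (≤-trans lo<hi hi≤n)
  ...   | x | refl with total x
  ...     | y , xy with closed xy ≤-refl lo<hi
  -- The partner `y` of the leftmost position `x` leaves two closed gaps, between `x` and `y` and
  -- after `y`. Both are even by induction, and `x` and `y` themselves add two.
  ...       | x≤y , y<hi = ℙ.⁻¹-injective (trans (sym (parity-suc (toℕ x))) (trans
      (closed⇒parity≡ k x<y (<⇒≤ (Fin.toℕ<n y)) (≤-trans (<⇒≤ y<hi) hi≤1+x+k) (inside-closed xy))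
      (trans (sym (ℙ.suc-homo-⁻¹ (toℕ y))) (cong _⁻¹
      (closed⇒parity≡ k y<hi hi≤n (≤-trans hi≤1+x+k (+-monoˡ-≤ k (≤-trans x<y (n≤1+n _))))
                        (after-closed xy x<y closed))))))
    where
    x<y      = ≤∧≢⇒< x≤y (irrefl xy ∘ Fin.toℕ-injective)
    hi≤1+x+k = subst (hi ≤_) (+-suc (toℕ x) k) hi≤lo+1+k
    parity-suc : ∀ m → parity (suc m) ≡ parity m ⁻¹
    parity-suc m = sym (ℙ.⁻¹-selfInverse (ℙ.suc-homo-⁻¹ m))

  private
    -- The positions strictly between `x` and `y` form a closed interval, so `suc (toℕ x)` and
    -- `toℕ y` have equal parity.
    ordered⇒parity≢ : ∀ {x y} → M x y → toℕ x < toℕ y → parity (toℕ x) ≢ parity (toℕ y)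
    ordered⇒parity≢ {x} {y} xy x<y px≡py = p≢p⁻¹ (parity (toℕ y))
      (trans (sym px≡py) (trans (sym (ℙ.suc-homo-⁻¹ (toℕ x))) (cong _⁻¹
        (closed⇒parity≡ (toℕ y) x<y (<⇒≤ (Fin.toℕ<n y)) (m≤n+m (toℕ y) _) (inside-closed xy)))))

  matched⇒parity≢ : ∀ {x y} → M x y → parity (toℕ x) ≢ parity (toℕ y)
  matched⇒parity≢ {x} {y} xy with Fin.<-cmp x y
  ... | tri< x<y _ _ = ordered⇒parity≢ xy x<y
  ... | tri≈ _ x≡y _ = contradiction x≡y (irrefl xy)
  ... | tri> _ _ y<x = ≢-sym (ordered⇒parity≢ (symm xy) y<x)

-- Regular graphs with as many pages as the degree.

module _ {n k : ℕ} {G : Graph n} (regular : ∀ v → degree G v ≡ k)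
         (E : MatchingBookEmbedding G k) where
  open Graph G
  open MatchingBookEmbedding E

  private
    Page : Fin k → Rel (Fin n) 0ℓ
    Page c u v = ∃ λ e → colour e ≡ c × Joins {G = G} e u v

    page-functional : ∀ {c u v w} → Page c u v → Page c u w → v ≡ w
    page-functional {v = v} {w} (e , ec , euv) (f , fc , fuw) with v Fin.≟ w
    ... | yes v≡w = v≡w
    ... | no  v≢w = contradiction (joins⇒share {e = e} {f} euv fuw)
      (matching e f (λ e≡f → v≢w (joins-functional {e = e} e≡f euv fuw)) (trans ec (sym fc)))

    module Star (u : Fin n) where
      neighbours : List (Fin n)
      neighbours = filter (adj? u) (allFin n)

      edgeTo : ∀ i → ∃ λ e → Joins {G = G} e u (List.lookup neighbours i)
      edgeTo i = edgeBetween {G = G} (proj₂ (∈-filter⁻ (adj? u) {xs = allFin n} (∈-lookup i)))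

      colourOf : Fin (degree G u) → Fin k
      colourOf = colour ∘ proj₁ ∘ edgeTo

      colour-injective : Injective _≡_ _≡_ colourOf
      colour-injective {i} {j} ci≡cj =
        lookup-injective (Unique.filter⁺ (adj? u) (Unique.allFin⁺ n)) i j
          (page-functional (_ , ci≡cj , proj₂ (edgeTo i)) (_ , refl , proj₂ (edgeTo j)))

    -- The `k` edges at `u` have pairwise distinct colours because pages are matchings; by counting,
    -- each of the `k` colours occurs among them.
    page-total : ∀ c u → ∃ (Page c u)
    page-total c u with injective⇒surjective (regular u) colourOf colour-injective c
      where open Star u
    ... | i , ci≡c = _ , _ , ci≡c , proj₂ (Star.edgeTo u i)

    module Positions (c : Fin k) where

      -- The page is carried from vertices to positions on the circle, where the parity argument
      -- takes place.
      Matched : Rel (Fin n) 0ℓ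
      Matched x y = Page c (order ⟨$⟩ˡ x) (order ⟨$⟩ˡ y)

      from-injective : ∀ {x y} → order ⟨$⟩ˡ x ≡ order ⟨$⟩ˡ y → x ≡ y
      from-injective eq = trans (sym (inverseʳ order)) (trans (cong (order ⟨$⟩ʳ_) eq)
        (inverseʳ order))

      matched-total : ∀ x → ∃ (Matched x)
      matched-total x with page-total c (order ⟨$⟩ˡ x)
      ... | v , page = order ⟨$⟩ʳ v , subst (Page c _) (sym (inverseˡ order)) page

      matched-sym : Symmetric Matched
      matched-sym (e , ec , exy) = e , ec , joins-sym {e = e} exy

      matched-irrefl : ∀ {x y} → Matched x y → x ≢ y
      matched-irrefl (e , _ , exy) refl = joins-irrefl {e = e} exy refl

      matched-functional : ∀ {x y z} → Matched x y → Matched x z → y ≡ z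
      matched-functional xy xz = from-injective (page-functional xy xz)

      matched-noncrossing : ∀ {x y u v} → Matched x y → Matched u v → x Fin.< u → u Fin.< y →
                            ¬ v Fin.< x × ¬ y Fin.< v
      matched-noncrossing {x} {y} {u} {v} xy@(e , ec , exy) uv@(f , fc , fuv) x<u u<y =
        -- In both cases `u` lies on the arc from `x` to `y` and `v` on the arc from `y` to `x`.
        (λ v<x → uncrossed (inj₁ (inj₁ (x<u , u<y) , inj₂ (inj₁ (v<x , Fin.<-trans x<u u<y))))) ,
        (λ y<v → uncrossed (inj₁ (inj₁ (x<u , u<y) , inj₂ (inj₂ (Fin.<-trans x<u u<y , y<v)))))
        where
        e≢f : e ≢ f
        e≢f e≡f = [ Fin.<⇒≢ x<u ∘ sym ∘ from-injective , Fin.<⇒≢ u<y ∘ from-injective ]′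
          (joins-endpoint {e = e} e≡f exy fuv)

        uncrossed : ¬ ChordsCross x y u v
        uncrossed cross = noncrossing e f e≢f (trans ec (sym fc))
          (chordsCross⇒crosses order {e} {f} exy fuv
            (subst₂ (λ x y → ChordsCross x y _ _) (sym (inverseʳ order)) (sym (inverseʳ order))
            (subst₂ (ChordsCross x y) (sym (inverseʳ order)) (sym (inverseʳ order)) cross)))

      open NoncrossingPerfectMatching Matched matched-total matched-sym matched-irrefl
        matched-functional matched-noncrossing public

  -- Each edge lies on the page of its own colour, so the parity of the position is a proper
  -- 2-colouring of the graph.
  adjacent⇒parity≢ : ∀ {u v} → Adj u v →
                     parity (toℕ (order ⟨$⟩ʳ u)) ≢ parity (toℕ (order ⟨$⟩ʳ v))
  adjacent⇒parity≢ uv with e , euv ← edgeBetween {G = G} uv =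
    Positions.matched⇒parity≢ (colour e)
      (e , refl , subst₂ (Joins e) (sym (inverseˡ order)) (sym (inverseˡ order)) euv)

  triangle-free : ∀ {u v w} → Adj u v → Adj v w → ¬ Adj u w
  triangle-free uv vw uw =
    no-three-parities (adjacent⇒parity≢ uv) (adjacent⇒parity≢ vw) (adjacent⇒parity≢ uw)

-- Arithmetic modulo n.

[m%n+o]%n≡[m+o]%n : ∀ m o n .{{_ : NonZero n}} → (m % n + o) % n ≡ (m + o) % n
[m%n+o]%n≡[m+o]%n m o n = begin
  (m % n + o) % n          ≡⟨ %-distribˡ-+ (m % n) o n ⟩
  (m % n % n + o % n) % n  ≡⟨ cong (λ r → (r + o % n) % n) (m%n%n≡m%n m n) ⟩
  (m % n + o % n) % n      ≡⟨ %-distribˡ-+ m o n ⟨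
  (m + o) % n              ∎
  where open ≡-Reasoning

-- A step of `d` followed by one of `n ∸ d` is a full turn; adding `n ∸ d` thus plays the role of
-- subtracting `d`.
[[m+d]%n+[n∸d]]%n≡m%n : ∀ m {d n} .{{_ : NonZero n}} → d ≤ n → ((m + d) % n + (n ∸ d)) % n ≡ m % n
[[m+d]%n+[n∸d]]%n≡m%n m {d} {n} d≤n = begin
  ((m + d) % n + (n ∸ d)) % n  ≡⟨ [m%n+o]%n≡[m+o]%n (m + d) (n ∸ d) n ⟩
  (m + d + (n ∸ d)) % n        ≡⟨ cong (_% n) (+-assoc m d (n ∸ d)) ⟩
  (m + (d + (n ∸ d))) % n      ≡⟨ cong (λ x → (m + x) % n) (m+[n∸m]≡n d≤n) ⟩
  (m + n) % n                  ≡⟨ [m+n]%n≡m%n m n ⟩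
  m % n                        ∎
  where open ≡-Reasoning

%-reverse : ∀ {m o d n} .{{_ : NonZero n}} → m < n → d ≤ n → o ≡ (m + d) % n → m ≡ (o + (n ∸ d)) % n
%-reverse {m} m<n d≤n refl = sym (trans ([[m+d]%n+[n∸d]]%n≡m%n m d≤n) (m<n⇒m%n≡m m<n))

%-cancelˡ-+ : ∀ {d n} .{{_ : NonZero n}} → d ≤ n → ∀ a b → (d + a) % n ≡ (d + b) % n → a % n ≡ b % n
%-cancelˡ-+ {d} {n} d≤n a b eq = begin
  a % n                        ≡⟨ [[m+d]%n+[n∸d]]%n≡m%n a d≤n ⟨
  ((a + d) % n + (n ∸ d)) % n  ≡⟨ cong (λ x → (x + (n ∸ d)) % n) a+d≡b+d ⟩
  ((b + d) % n + (n ∸ d)) % n  ≡⟨ [[m+d]%n+[n∸d]]%n≡m%n b d≤n ⟩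
  b % n                        ∎
  where
  open ≡-Reasoning
  a+d≡b+d = trans (cong (_% n) (+-comm a d)) (trans eq (cong (_% n) (+-comm d b)))

-- Degrees and triangles in C(n,{1,2,3}).

same-elements⇒length≡ : ∀ {A : Set} {xs ys : List A} → Unique xs → Unique ys →
                        (∀ {z} → z ∈ xs → z ∈ ys) → (∀ {z} → z ∈ ys → z ∈ xs) →
                        length xs ≡ length ys
same-elements⇒length≡ xs! ys! xs⊆ys ys⊆xs =
  ↭-length (∼bag⇒↭ (unique∧set⇒bag xs! ys! (mk⇔ xs⊆ys ys⊆xs)))

-- The vertex `v` ensures that the value `k` is attained; over no vertices the maximum would be its
-- default 0.
regular⇒maxDegree : ∀ {n k} (G : Graph n) → Fin n → (∀ v → degree G v ≡ k) → maxDegree G ≡ k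
regular⇒maxDegree {n} G v regular = ≤-antisym
  (max≤v⁺ {xs = degrees} z≤n (All.map⁺ (All.tabulate λ {u} _ → ≤-reflexive (regular u))))
  (v≤max⁺ 0 degrees
    (inj₂ (lose (∈-map⁺ (degree G) (∈-allFin v)) (≤-reflexive (sym (regular v))))))
  where
  degrees : List ℕ
  degrees = map (degree G) (allFin n)

module _ {n : ℕ} where

  step⇒shift : ∀ d u {v : Fin n} .{{_ : NonZero n}} → Step d u v → v ≡ (toℕ u + d) mod n
  step⇒shift d u step = Fin.toℕ-injective (trans step (sym (Fin.toℕ-fromℕ< _)))

  shift⇒step : ∀ d u {v : Fin n} .{{_ : NonZero n}} → v ≡ (toℕ u + d) mod n → Step d u v
  shift⇒step d u refl = Fin.toℕ-fromℕ< _

step-reverse : ∀ {n d} (u v : Fin n) → d ≤ n → Step d u v → Step (n ∸ d) v u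
step-reverse {suc _} u v d≤n step = %-reverse (Fin.toℕ<n u) d≤n step

-- The neighbours of `v` are its shifts by 1, 2, 3 forwards and backwards. These are six distinct
-- residues because `6 < n` gives `3 < n ∸ 3`.
circulant₁₂₃-regular : ∀ {n} (isS : IsConnectionSet n (1 ∷ 2 ∷ 3 ∷ [])) → 6 < n →
                       ∀ v → degree (circulant n _ isS) v ≡ 6
circulant₁₂₃-regular {n} isS 6<n v with k , refl ← m≤n⇒∃[o]m+o≡n 6<n =
  same-elements⇒length≡ (Unique.filter⁺ (adj? v) (Unique.allFin⁺ n)) shifts-unique
    (adjacent⇒shift ∘ proj₂ ∘ ∈-filter⁻ (adj? v) {xs = allFin n})
    (λ {w} w∈ → ∈-filter⁺ (adj? v) (∈-allFin w) (shift⇒adjacent w∈))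
  where
  open Graph (circulant n _ isS)
  open ≡-Reasoning

  shift : ℕ → Fin n
  shift d = (toℕ v + d) mod n

  offsets : List ℕ
  -- Here `n` is `7 + k`, so the last three offsets are `n ∸ 3`, `n ∸ 2` and `n ∸ 1`, the backward
  -- steps.
  offsets = 1 ∷ 2 ∷ 3 ∷ 4 + k ∷ 5 + k ∷ 6 + k ∷ []

  offsets-increasing : AllPairs (λ a b → a < b × b < n) offsets
  offsets-increasing = Linked⇒AllPairs (λ (a<b , _) (b<c , c<n) → <-trans a<b b<c , c<n)
    ( (≤-refl , m≤m+n 3 _) ∷ (≤-refl , m≤m+n 4 _) ∷ (m≤m+n 4 k , m≤n+m _ 2)
    ∷ (≤-refl , m≤n+m _ 1) ∷ (≤-refl , ≤-refl) ∷ [-])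

  shift-≢ : ∀ {a b} → a < b × b < n → shift a ≢ shift b
  shift-≢ {a} {b} (a<b , b<n) eq = <⇒≢ a<b (begin
    a      ≡⟨ m<n⇒m%n≡m (<-trans a<b b<n) ⟨
    a % n  ≡⟨ %-cancelˡ-+ (<⇒≤ (Fin.toℕ<n v)) a b (trans (sym (Fin.toℕ-fromℕ< _))
                (trans (cong toℕ eq) (Fin.toℕ-fromℕ< _))) ⟩
    b % n  ≡⟨ m<n⇒m%n≡m b<n ⟩
    b      ∎)

  shifts-unique : Unique (map shift offsets)
  shifts-unique = AllPairs.map⁺ (AllPairs.map shift-≢ offsets-increasing)

  adjacent⇒shift : ∀ {w} → Adj v w → w ∈ map shift offsets
  adjacent⇒shift {w} (here (inj₁ s))                 = here (step⇒shift 1 v s)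
  adjacent⇒shift {w} (there (here (inj₁ s)))         = there (here (step⇒shift 2 v s))
  adjacent⇒shift {w} (there (there (here (inj₁ s)))) = there (there (here (step⇒shift 3 v s)))
  adjacent⇒shift {w} (there (there (here (inj₂ s)))) =
    there (there (there (here (step⇒shift (n ∸ 3) v (step-reverse {d = 3} w v (m≤m+n 3 _) s)))))
  adjacent⇒shift {w} (there (here (inj₂ s))) =
    there (there (there (there (here
      (step⇒shift (n ∸ 2) v (step-reverse {d = 2} w v (m≤m+n 2 _) s))))))
  adjacent⇒shift {w} (here (inj₂ s)) =
    there (there (there (there (there (here
      (step⇒shift (n ∸ 1) v (step-reverse {d = 1} w v (m≤m+n 1 _) s)))))))

  reverse-shift : ∀ {w} d → d ≤ n → w ≡ shift (n ∸ d) → Step d w v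
  reverse-shift {w} d d≤n eq = subst (λ d → Step d w v) (m∸[m∸n]≡n d≤n)
    (step-reverse {d = n ∸ d} v w (m∸n≤m n d) (shift⇒step (n ∸ d) v eq))

  shift⇒adjacent : ∀ {w} → w ∈ map shift offsets → Adj v w
  shift⇒adjacent (here eq)                         = here (inj₁ (shift⇒step 1 v eq))
  shift⇒adjacent (there (here eq))                 = there (here (inj₁ (shift⇒step 2 v eq)))
  shift⇒adjacent (there (there (here eq)))         = there (there (here (inj₁ (shift⇒step 3 v eq))))
  shift⇒adjacent (there (there (there (here eq)))) =
    there (there (here (inj₂ (reverse-shift 3 (m≤m+n 3 _) eq))))
  shift⇒adjacent (there (there (there (there (here eq))))) =
    there (here (inj₂ (reverse-shift 2 (m≤m+n 2 _) eq)))
  shift⇒adjacent (there (there (there (there (there (here eq)))))) =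
    here (inj₂ (reverse-shift 1 (m≤m+n 1 _) eq))

circulant₁₂₃-triangle : ∀ {n} (isS : IsConnectionSet n (1 ∷ 2 ∷ 3 ∷ [])) → 6 < n →
  let open Graph (circulant n _ isS) in ∃ λ u → ∃ λ v → ∃ λ w → Adj u v × Adj v w × Adj u w
circulant₁₂₃-triangle {n} isS 6<n with k , refl ← m≤n⇒∃[o]m+o≡n 6<n =
  -- With `n` in the form `7 + k` the remainders compute, and `refl` proves each step.
  Fin.zero , Fin.suc Fin.zero , Fin.suc (Fin.suc Fin.zero) ,
  here (inj₁ refl) , here (inj₁ refl) , there (here (inj₁ refl))

circulant₁₂₃-¬dispersable : ∀ {n} (isS : IsConnectionSet n (1 ∷ 2 ∷ 3 ∷ [])) → 6 < n →
                            ¬ Dispersable (circulant n _ isS)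
circulant₁₂₃-¬dispersable isS 6<n E with u , _ , _ , uv , vw , uw ← circulant₁₂₃-triangle isS 6<n =
  triangle-free {G = circulant _ _ isS}
    (λ x → trans (regular x) (sym (regular⇒maxDegree (circulant _ _ isS) u regular))) E uv vw uw
  where regular = circulant₁₂₃-regular isS 6<n

-- Noncrossing chords as laminar intervals.

-- The formula of `Cyclic`, restated for positions on an unrolled circle, which may be `n` or
-- larger.
Cyclicᴺ : ℕ → ℕ → ℕ → Set
Cyclicᴺ a b c = (a < b × b < c) ⊎ (b < c × c < a) ⊎ (c < a × a < b)

cyclicᴺ-inside : ∀ {x y z} → x < y → Cyclicᴺ x z y → x < z × z < y
cyclicᴺ-inside x<y (inj₁ p)                     = p
cyclicᴺ-inside x<y (inj₂ (inj₁ (_ , y<x)))      = contradiction y<x (<⇒≯ x<y)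
cyclicᴺ-inside x<y (inj₂ (inj₂ (y<x , _)))      = contradiction y<x (<⇒≯ x<y)

cyclicᴺ-outside : ∀ {x y z} → x < y → Cyclicᴺ y z x → z < x ⊎ y < z
cyclicᴺ-outside x<y (inj₁ (y<z , _))        = inj₂ y<z
cyclicᴺ-outside x<y (inj₂ (inj₁ (z<x , _))) = inj₁ z<x
cyclicᴺ-outside x<y (inj₂ (inj₂ (_ , y<z))) = inj₂ y<z

-- Disjoint or nested, with no common endpoint: this single condition yields both requirements on a
-- page, noncrossing and matching.
data Laminar (x y x′ y′ : ℕ) : Set where
  before  : y < x′ → Laminar x y x′ y′
  after   : y′ < x → Laminar x y x′ y′
  around  : x < x′ → y′ < y → Laminar x y x′ y′
  within  : x′ < x → y < y′ → Laminar x y x′ y′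

module _ {x y x′ y′ : ℕ} (x<y : x < y) (x′<y′ : x′ < y′) where

  laminar⇒disjoint : Laminar x y x′ y′ → ¬ ((x ≡ x′ ⊎ x ≡ y′) ⊎ (y ≡ x′ ⊎ y ≡ y′))
  laminar⇒disjoint (before y<x′) =
    [ [ <⇒≢ (<-trans x<y y<x′) , <⇒≢ (<-trans x<y (<-trans y<x′ x′<y′)) ]′
    , [ <⇒≢ y<x′ , <⇒≢ (<-trans y<x′ x′<y′) ]′ ]′
  laminar⇒disjoint (after y′<x) =
    [ [ >⇒≢ (<-trans x′<y′ y′<x) , >⇒≢ y′<x ]′
    , [ >⇒≢ (<-trans x′<y′ (<-trans y′<x x<y)) , >⇒≢ (<-trans y′<x x<y) ]′ ]′
  laminar⇒disjoint (around x<x′ y′<y) =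
    [ [ <⇒≢ x<x′ , <⇒≢ (<-trans x<x′ x′<y′) ]′ , [ >⇒≢ (<-trans x′<y′ y′<y) , >⇒≢ y′<y ]′ ]′
  laminar⇒disjoint (within x′<x y<y′) =
    [ [ >⇒≢ x′<x , <⇒≢ (<-trans x<y y<y′) ]′ , [ >⇒≢ (<-trans x′<x x<y) , <⇒≢ y<y′ ]′ ]′

  laminar⇒uncrossed : Laminar x y x′ y′ →
    ¬ ((Cyclicᴺ x x′ y × Cyclicᴺ y y′ x) ⊎ (Cyclicᴺ x y′ y × Cyclicᴺ y x′ x))
  laminar⇒uncrossed l (inj₁ (p , q)) with cyclicᴺ-inside x<y p | cyclicᴺ-outside x<y q | l
  ... | x<x′ , x′<y | _         | before y<x′   = <⇒≯ x′<y y<x′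
  ... | x<x′ , x′<y | _         | after y′<x    = <⇒≯ (<-trans x<x′ x′<y′) y′<x
  ... | x<x′ , x′<y | inj₁ y′<x | around _ _    = <⇒≯ (<-trans x<x′ x′<y′) y′<x
  ... | x<x′ , x′<y | inj₂ y<y′ | around _ y′<y = <⇒≯ y<y′ y′<y
  ... | x<x′ , x′<y | _         | within x′<x _ = <⇒≯ x<x′ x′<x
  laminar⇒uncrossed l (inj₂ (p , q)) with cyclicᴺ-inside x<y p | cyclicᴺ-outside x<y q | l
  ... | x<y′ , y′<y | _         | before y<x′   = <⇒≯ (<-trans y<x′ x′<y′) y′<y
  ... | x<y′ , y′<y | _         | after y′<x    = <⇒≯ x<y′ y′<x
  ... | x<y′ , y′<y | inj₁ x′<x | around x<x′ _ = <⇒≯ x<x′ x′<x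
  ... | x<y′ , y′<y | inj₂ y<x′ | around _ _    = <⇒≯ (<-trans y<x′ x′<y′) y′<y
  ... | x<y′ , y′<y | _         | within _ y<y′ = <⇒≯ y<y′ y′<y

-- The intervals [x , y] centred in one of the blocks [c + kp , c + kp + p).
Centred : ℕ → ℕ → ℕ → ℕ → Set
Centred p c x y = ∃₂ λ k r → x ≡ c + k * p + r × y + suc r ≡ c + k * p + p

module _ {p c : ℕ} where

  private
    next-block : ∀ {x y x′ y′ k k′ r r′} → x ≡ c + k * p + r → y + suc r ≡ c + k * p + p →
                 x′ ≡ c + k′ * p + r′ → y′ + suc r′ ≡ c + k′ * p + p → k < k′ → y < x′
    next-block {x} {y} {x′} {y′} {k} {k′} {r} {r′} x≡ y≡ x′≡ y′≡ k<k′ = begin-strict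
      y               <⟨ m<m+n y (s≤s z≤n) ⟩
      y + suc r       ≡⟨ y≡ ⟩
      c + k * p + p   ≡⟨ +-assoc c (k * p) p ⟩
      c + (k * p + p) ≡⟨ cong (c +_) (+-comm (k * p) p) ⟩
      c + suc k * p   ≤⟨ +-monoʳ-≤ c (*-monoˡ-≤ p k<k′) ⟩
      c + k′ * p      ≤⟨ m≤m+n _ r′ ⟩
      c + k′ * p + r′ ≡⟨ x′≡ ⟨
      x′              ∎
      where open ≤-Reasoning

    inner : ∀ {b b′ x y x′ y′ r r′} → x ≡ b + r → y + suc r ≡ b′ →
            x′ ≡ b + r′ → y′ + suc r′ ≡ b′ → r < r′ → x < x′ × y′ < y
    inner {b} {b′} {x} {y} {x′} {y′} {r} {r′} refl y≡ refl y′≡ r<r′ =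
      +-monoʳ-< b r<r′ ,
      +-cancelʳ-< (suc r) y′ y (subst (y′ + suc r <_) (trans y′≡ (sym y≡))
        (+-monoʳ-< y′ (s≤s r<r′)))

  -- Intervals in different blocks are disjoint. Two in the same block have the same centre, so the
  -- one with smaller `r` surrounds the other, and equal `r` makes them coincide.
  centred⇒laminar : ∀ {x y x′ y′} → Centred p c x y → Centred p c x′ y′ →
                    (x ≡ x′ × y ≡ y′) ⊎ Laminar x y x′ y′
  centred⇒laminar {y = y} {y′ = y′} (k , r , x≡ , y≡) (k′ , r′ , x′≡ , y′≡)
    with <-cmp k k′ | <-cmp r r′
  ... | tri< k<k′ _ _ | _              = inj₂ (before (next-block {r = r} x≡ y≡ x′≡ y′≡ k<k′))
  ... | tri> _ _ k′<k | _              = inj₂ (after (next-block {r = r′} x′≡ y′≡ x≡ y≡ k′<k))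
  ... | tri≈ _ refl _ | tri< r<r′ _ _  =
    let (x<x′ , y′<y) = inner x≡ y≡ x′≡ y′≡ r<r′ in inj₂ (around x<x′ y′<y)
  ... | tri≈ _ refl _ | tri> _ _ r′<r  =
    let (x′<x , y<y′) = inner x′≡ y′≡ x≡ y≡ r′<r in inj₂ (within x′<x y<y′)
  ... | tri≈ _ refl _ | tri≈ _ refl _  =
    inj₁ (trans x≡ (sym x′≡) , +-cancelʳ-≡ (suc r) y y′ (trans y≡ (sym y′≡)))

-- Unrolling the circle onto an interval.

-- Cutting the circle before the point c unrolls it onto the interval [c , c + n).
data Lift {n : ℕ} (c : ℕ) (v : Fin n) : ℕ → Set where
  unshifted : c ≤ toℕ v → Lift c v (toℕ v)
  shifted   : toℕ v < c → Lift c v (toℕ v + n)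

module _ {n c : ℕ} where

  lift : ∀ (v : Fin n) → ∃ (Lift c v)
  lift v with c ≤? toℕ v
  ... | yes c≤v = _ , unshifted c≤v
  ... | no  c≰v = _ , shifted (≰⇒> c≰v)

  lift-functional : ∀ {v : Fin n} {x y} → Lift c v x → Lift c v y → x ≡ y
  lift-functional (unshifted _)   (unshifted _)   = refl
  lift-functional (shifted _)     (shifted _)     = refl
  lift-functional (unshifted c≤v) (shifted v<c)   = contradiction v<c (≤⇒≯ c≤v)
  lift-functional (shifted v<c)   (unshifted c≤v) = contradiction v<c (≤⇒≯ c≤v)

  lift-lower : ∀ {v : Fin n} {x} → c ≤ n → Lift c v x → c ≤ x
  lift-lower c≤n (unshifted c≤v) = c≤v
  lift-lower c≤n (shifted _)     = ≤-trans c≤n (m≤n+m n _)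

  lift-upper : ∀ {v : Fin n} {x} → Lift c v x → x < c + n
  lift-upper {v} (unshifted _) = <-≤-trans (Fin.toℕ<n v) (m≤n+m n c)
  lift-upper (shifted v<c)     = +-monoˡ-< n v<c

  lift-% : ∀ {v : Fin n} {x p} .{{_ : NonZero p}} → p ∣ n → Lift c v x → x % p ≡ toℕ v % p
  lift-% p∣n (unshifted _)   = refl
  lift-% {v} p∣n (shifted _) = %-remove-+ʳ (toℕ v) p∣n

  -- The window from `c` to `c + n` contains exactly one number of each residue modulo `n`.
  mkLift : ∀ {v : Fin n} {x} .{{_ : NonZero n}} →
           c ≤ n → c ≤ x → x < c + n → toℕ v ≡ x % n → Lift c v x
  mkLift {v} {x} c≤n c≤x x<c+n v≡x%n with x <? n
  ... | yes x<n = subst (Lift c v) v≡x (unshifted (subst (c ≤_) (sym v≡x) c≤x))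
    where
    v≡x : toℕ v ≡ x
    v≡x = trans v≡x%n (m<n⇒m%n≡m x<n)
  ... | no  x≮n = subst (Lift c v) v+n≡x
    (shifted (+-cancelʳ-< n (toℕ v) c (subst (_< c + n) (sym v+n≡x) x<c+n)))
    where
    n≤x = ≮⇒≥ x≮n

    x∸n<n : x ∸ n < n
    x∸n<n = +-cancelʳ-< n (x ∸ n) n
      (subst (_< n + n) (sym (m∸n+n≡m n≤x)) (<-≤-trans x<c+n (+-monoˡ-≤ n c≤n)))

    v+n≡x : toℕ v + n ≡ x
    v+n≡x = trans (cong (_+ n) (trans v≡x%n (trans (sym (m≤n⇒[n∸m]%m≡n%m n≤x)) (m<n⇒m%n≡m x∸n<n))))
                  (m∸n+n≡m n≤x)

  lift-injective : ∀ {u v : Fin n} {x y} → Lift c u x → Lift c v y → x ≡ y → u ≡ v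
  lift-injective (unshifted _) (unshifted _) eq = Fin.toℕ-injective eq
  lift-injective {u} {v} (shifted _)   (shifted _)   eq =
    Fin.toℕ-injective (+-cancelʳ-≡ n (toℕ u) (toℕ v) eq)
  lift-injective {u} (unshifted _) (shifted _)   eq =
    contradiction eq (<⇒≢ (<-≤-trans (Fin.toℕ<n u) (m≤n+m n _)))
  lift-injective {v = v} (shifted _)   (unshifted _) eq =
    contradiction eq (>⇒≢ (<-≤-trans (Fin.toℕ<n v) (m≤n+m n _)))

  private
    n-far : ∀ (u : Fin n) {x} → toℕ u < x + n
    n-far u {x} = <-≤-trans (Fin.toℕ<n u) (m≤n+m n x)

    -- The shifted positions are those below `c`, hence an initial segment of the increasing triple.
    -- Moving it to the end is a rotation.
    increasing⇒cyclicᴺ : ∀ {a b d : Fin n} {x y z} → a Fin.< b × b Fin.< d →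
                         Lift c a x → Lift c b y → Lift c d z → Cyclicᴺ x y z
    increasing⇒cyclicᴺ (a<b , b<d) (unshifted _) (unshifted _) (unshifted _) = inj₁ (a<b , b<d)
    increasing⇒cyclicᴺ {d = d} (a<b , b<d) (shifted _) (unshifted _) (unshifted _) =
      inj₂ (inj₁ (b<d , n-far d))
    increasing⇒cyclicᴺ {d = d} (a<b , b<d) (shifted _) (shifted _) (unshifted _) =
      inj₂ (inj₂ (n-far d , +-monoˡ-< n a<b))
    increasing⇒cyclicᴺ (a<b , b<d) (shifted _) (shifted _) (shifted _) =
      inj₁ (+-monoˡ-< n a<b , +-monoˡ-< n b<d)
    increasing⇒cyclicᴺ (a<b , _) (unshifted c≤a) (shifted b<c) _ =
      contradiction (<-trans a<b b<c) (≤⇒≯ c≤a)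
    increasing⇒cyclicᴺ (_ , b<d) _ (unshifted c≤b) (shifted d<c) =
      contradiction (<-trans b<d d<c) (≤⇒≯ c≤b)

    rotate : ∀ {x y z} → Cyclicᴺ y z x → Cyclicᴺ x y z
    rotate = [ inj₂ ∘ inj₁ , [ inj₂ ∘ inj₂ , inj₁ ]′ ]′

  cyclic⇒cyclicᴺ : ∀ {a b d : Fin n} {x y z} → Lift c a x → Lift c b y → Lift c d z →
                   Cyclic a b d → Cyclicᴺ x y z
  cyclic⇒cyclicᴺ la lb ld (inj₁ abd)        = increasing⇒cyclicᴺ abd la lb ld
  cyclic⇒cyclicᴺ la lb ld (inj₂ (inj₁ bda)) = rotate (increasing⇒cyclicᴺ bda lb ld la)
  cyclic⇒cyclicᴺ la lb ld (inj₂ (inj₂ dab)) = rotate (rotate (increasing⇒cyclicᴺ dab ld la lb))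

  -- A start at offset `r` in its block leads to an end at offset `r + d`, its mirror image because
  -- `r + d + suc r ≡ p`. As `p` divides `n`, the window is made of `q` whole blocks, so the edge
  -- never leaves it and the end lifts to `x + d`.
  step⇒centred : ∀ {p d r} {u v : Fin n} .{{_ : NonZero n}} .{{_ : NonZero p}} →
                 p ∣ n → c < p → c ≤ n → r + d + suc r ≡ p →
                 toℕ u % p ≡ (c + r) % p → toℕ v ≡ (toℕ u + d) % n →
                 ∃₂ λ x y → Lift c u x × Lift c v y × Centred p c x y × y ≡ x + d
  step⇒centred {p} {d} {r} {u} {v} p∣n@(divides q n≡q*p) c<p c≤n r+d+1+r≡p u≡c+r v≡u+d
    with x , u↑x ← lift u =
    x , x + d , u↑x , mkLift c≤n (≤-trans c≤x (m≤m+n x d)) x+d<c+n v≡x+d , (k , r , x≡ , y≡) , refl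
    where
    c≤x = lift-lower c≤n u↑x

    k = (x ∸ c) / p

    c+[x∸c]≡x = m+[n∸m]≡n c≤x

    r<p : r < p
    r<p = subst (r <_) r+d+1+r≡p (<-≤-trans (n<1+n r) (m≤n+m (suc r) (r + d)))

    [x∸c]%p≡r : (x ∸ c) % p ≡ r
    [x∸c]%p≡r = trans (%-cancelˡ-+ (<⇒≤ c<p) (x ∸ c) r
      (trans (cong (_% p) c+[x∸c]≡x) (trans (lift-% p∣n u↑x) u≡c+r))) (m<n⇒m%n≡m r<p)

    x∸c≡ : x ∸ c ≡ r + k * p
    x∸c≡ = trans (m≡m%n+[m/n]*n (x ∸ c) p) (cong (_+ k * p) [x∸c]%p≡r)

    x≡ : x ≡ c + k * p + r
    x≡ = begin
      x                ≡⟨ c+[x∸c]≡x ⟨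
      c + (x ∸ c)      ≡⟨ cong (c +_) x∸c≡ ⟩
      c + (r + k * p)  ≡⟨ cong (c +_) (+-comm r (k * p)) ⟩
      c + (k * p + r)  ≡⟨ +-assoc c (k * p) r ⟨
      c + k * p + r    ∎
      where open ≡-Reasoning

    y≡ : x + d + suc r ≡ c + k * p + p
    y≡ = begin
      x + d + suc r                  ≡⟨ cong (λ x → x + d + suc r) x≡ ⟩
      c + k * p + r + d + suc r      ≡⟨ cong (_+ suc r) (+-assoc (c + k * p) r d) ⟩
      c + k * p + (r + d) + suc r    ≡⟨ +-assoc (c + k * p) (r + d) (suc r) ⟩
      c + k * p + (r + d + suc r)    ≡⟨ cong (c + k * p +_) r+d+1+r≡p ⟩
      c + k * p + p                  ∎
      where open ≡-Reasoning

    k<q : k < q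
    k<q = *-cancelʳ-< p k q (begin-strict
      k * p      ≤⟨ m/n*n≤m (x ∸ c) p ⟩
      x ∸ c      <⟨ +-cancelˡ-< c (x ∸ c) n (subst (_< c + n) (sym c+[x∸c]≡x) (lift-upper u↑x)) ⟩
      n          ≡⟨ n≡q*p ⟩
      q * p      ∎)
      where open ≤-Reasoning

    x+d<c+n : x + d < c + n
    x+d<c+n = begin-strict
      x + d            <⟨ m<m+n (x + d) (s≤s z≤n) ⟩
      x + d + suc r    ≡⟨ y≡ ⟩
      c + k * p + p    ≡⟨ +-assoc c (k * p) p ⟩
      c + (k * p + p)  ≡⟨ cong (c +_) (+-comm (k * p) p) ⟩
      c + suc k * p    ≤⟨ +-monoʳ-≤ c (*-monoˡ-≤ p k<q) ⟩
      c + q * p        ≡⟨ cong (c +_) n≡q*p ⟨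
      c + n            ∎
      where open ≤-Reasoning

    v≡x+d : toℕ v ≡ (x + d) % n
    v≡x+d = begin
      toℕ v                ≡⟨ v≡u+d ⟩
      (toℕ u + d) % n      ≡⟨ [m%n+o]%n≡[m+o]%n (toℕ u) d n ⟨
      (toℕ u % n + d) % n  ≡⟨ cong (λ r → (r + d) % n) (lift-% ∣-refl u↑x) ⟨
      (x % n + d) % n      ≡⟨ [m%n+o]%n≡[m+o]%n x d n ⟩
      (x + d) % n          ∎
      where open ≡-Reasoning

-- The page of an edge.

[m-mod-p+r]%p≡[m+r]%p : ∀ m r p .{{_ : NonZero p}} → (toℕ (m mod p) + r) % p ≡ (m + r) % p
[m-mod-p+r]%p≡[m+r]%p m r p =
  trans (cong (λ x → (x + r) % p) (Fin.toℕ-fromℕ< _)) ([m%n+o]%n≡[m+o]%n m r p)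

mod-toℕ : ∀ {n} (c : Fin n) .{{_ : NonZero n}} → toℕ c mod n ≡ c
mod-toℕ c = Fin.toℕ-injective (trans (Fin.toℕ-fromℕ< _) (m<n⇒m%n≡m (Fin.toℕ<n c)))

-- The page inj₁ c consists of the edges {i , i+3} and {i+1 , i+2} with
-- i ≡ c modulo 4, the page inj₂ c of the edges {i , i+2} with i ≡ c modulo 3.
PageName : Set
PageName = Fin 4 ⊎ Fin 3

period : PageName → ℕ
period (inj₁ _) = 4
period (inj₂ _) = 3

origin : PageName → ℕ
origin = [ toℕ , toℕ ]′

origin<period : ∀ h → origin h < period h
origin<period (inj₁ c) = Fin.toℕ<n c
origin<period (inj₂ c) = Fin.toℕ<n c

period≤4 : ∀ h → period h ≤ 4
period≤4 (inj₁ _) = ≤-refl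
period≤4 (inj₂ _) = n≤1+n 3

pageOfStep : ℕ → ℕ → PageName
-- This is the inner edge of the block that starts at `i - 1`, and `i + 3` is congruent to `i - 1`
-- modulo 4.
pageOfStep 1 i = inj₁ ((i + 3) mod 4)
pageOfStep 2 i = inj₂ (i mod 3)
-- This clause is meant for step 3 and serves as the default for other values.
pageOfStep _ i = inj₁ (i mod 4)

-- A difference above 3 means that the edge wraps around and starts at t.
pageOf : ℕ → ℕ → ℕ → PageName
pageOf n s t with t ∸ s ≤? 3
... | yes _ = pageOfStep (t ∸ s) s
... | no  _ = pageOfStep (n ∸ (t ∸ s)) t

pageOf-forward : ∀ n {d s t} → d ≤ 3 → t ≡ s + d → pageOf n s t ≡ pageOfStep d s
pageOf-forward n {d} {s} d≤3 refl with s + d ∸ s ≤? 3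
... | yes _   = cong (λ d → pageOfStep d s) (m+n∸m≡n s d)
... | no  d≰3 = contradiction (subst (_≤ 3) (sym (m+n∸m≡n s d)) d≤3) d≰3

-- Here `n` is the sum of `t ∸ s` and `d`. If `t ∸ s` were at most 3, then `n` would be at most 6;
-- so the test in `pageOf` recognises the wrapping edge.
pageOf-backward : ∀ {n d s t} → 6 < n → d ≤ 3 → t + d ≡ s + n → pageOf n s t ≡ pageOfStep d t
pageOf-backward {n} {d} {s} {t} 6<n d≤3 t+d≡s+n with t ∸ s ≤? 3
... | yes t∸s≤3 = contradiction 6<n (≤⇒≯ (+-cancelˡ-≤ s n 6 (begin
  s + n           ≡⟨ t+d≡s+n ⟨
  t + d           ≤⟨ +-mono-≤ (m≤n+m∸n t s) d≤3 ⟩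
  s + (t ∸ s) + 3 ≤⟨ +-monoˡ-≤ 3 (+-monoʳ-≤ s t∸s≤3) ⟩
  s + 3 + 3       ≡⟨ +-assoc s 3 3 ⟩
  s + 6           ∎)))
  where open ≤-Reasoning
... | no  t∸s≰3 = cong (λ d → pageOfStep d t) (begin
  n ∸ (t ∸ s)                ≡⟨ cong (_∸ (t ∸ s)) n≡ ⟩
  (t ∸ s) + d ∸ (t ∸ s)      ≡⟨ m+n∸m≡n (t ∸ s) d ⟩
  d                          ∎)
  where
  open ≡-Reasoning

  s≤t : s ≤ t
  s≤t = <⇒≤ (≰⇒> λ t≤s → t∸s≰3 (subst (_≤ 3) (sym (m≤n⇒m∸n≡0 t≤s)) z≤n))

  n≡ : n ≡ t ∸ s + d
  n≡ = +-cancelˡ-≡ s n (t ∸ s + d) (begin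
    s + n              ≡⟨ t+d≡s+n ⟨
    t + d              ≡⟨ cong (_+ d) (m+[n∸m]≡n s≤t) ⟨
    s + (t ∸ s) + d    ≡⟨ +-assoc s (t ∸ s) d ⟩
    s + (t ∸ s + d)    ∎)

step-cases : ∀ {d n i j} .{{_ : NonZero n}} → i < n → d ≤ n →
             j ≡ (i + d) % n → j ≡ i + d ⊎ i + d ≡ j + n
step-cases {d} {n} {i} {j} i<n d≤n j≡ with i + d <? n
... | yes i+d<n = inj₁ (trans j≡ (m<n⇒m%n≡m i+d<n))
... | no  i+d≮n = inj₂ (sym (trans (cong (_+ n) j≡i+d∸n) (m∸n+n≡m n≤i+d)))
  where
  n≤i+d = ≮⇒≥ i+d≮n

  i+d∸n<n : i + d ∸ n < n
  i+d∸n<n = +-cancelʳ-< n (i + d ∸ n) n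
    (subst (_< n + n) (sym (m∸n+n≡m n≤i+d)) (+-mono-<-≤ i<n d≤n))

  j≡i+d∸n : j ≡ i + d ∸ n
  j≡i+d∸n = trans j≡ (trans (sym (m≤n⇒[n∸m]%m≡n%m n≤i+d)) (m<n⇒m%n≡m i+d∸n<n))

module _ {n : ℕ} {G : Graph n} where
  open Edge

  edge-≡ : ∀ {e f : Edge G} → source e ≡ source f → target e ≡ target f → e ≡ f
  edge-≡ refl refl = refl

  joins-unique : ∀ {e f : Edge G} {u v} → Joins e u v → Joins f u v → e ≡ f
  joins-unique (inj₁ (p , q)) (inj₁ (p′ , q′)) = edge-≡ (trans p (sym p′)) (trans q (sym q′))
  joins-unique (inj₂ (p , q)) (inj₂ (p′ , q′)) = edge-≡ (trans p (sym p′)) (trans q (sym q′))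
  joins-unique {e} {f} (inj₁ (refl , refl)) (inj₂ (refl , refl)) =
    contradiction (source<target′ e) (<⇒≯ (source<target′ f))
  joins-unique {e} {f} (inj₂ (refl , refl)) (inj₁ (refl , refl)) =
    contradiction (source<target′ e) (<⇒≯ (source<target′ f))

-- The embedding in seven pages.

module Embedding {n : ℕ} (isS : IsConnectionSet n (1 ∷ 2 ∷ 3 ∷ []))
  (6<n : 6 < n) (12∣n : 12 ∣ n) where

  private
    instance
      n≢0 : NonZero n
      n≢0 = >-nonZero (<-trans z<s 6<n)

    G : Graph n
    G = circulant n _ isS

  open Graph G
  open Edge

  S : List ℕ
  S = 1 ∷ 2 ∷ 3 ∷ []

  ≤3 : ∀ {d} → d ∈ S → d ≤ 3
  ≤3 (here refl)                 = s≤s z≤n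
  ≤3 (there (here refl))         = s≤s (s≤s z≤n)
  ≤3 (there (there (here refl))) = ≤-refl

  ≥1 : ∀ {d} → d ∈ S → 1 ≤ d
  ≥1 (here refl)                 = s≤s z≤n
  ≥1 (there (here refl))         = s≤s z≤n
  ≥1 (there (there (here refl))) = s≤s z≤n

  ≤n : ∀ {d} → d ∈ S → d ≤ n
  ≤n d∈S = ≤-trans (≤3 d∈S) (≤-trans (m≤m+n 3 3) (<⇒≤ 6<n))

  page : Edge G → PageName
  page e = pageOf n (toℕ (source e)) (toℕ (target e))

  -- The edge is oriented along its step, from `u` to `u + d` modulo `n`. This differs from the
  -- orientation by `source` and `target` when the edge wraps around.
  record Directed (e : Edge G) : Set where
    field
      {d}     : ℕ
      {u v}   : Fin n
      d∈S     : d ∈ S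
      joins   : Joins e u v
      v≡u+d   : toℕ v ≡ (toℕ u + d) % n
      page≡   : page e ≡ pageOfStep d (toℕ u)

  -- Since the source is below the target, a step from the source cannot wrap and a step from the
  -- target must; each time one outcome of `step-cases` is absurd.
  direct : ∀ e → Directed e
  direct e@(edge s t s<t′ st′) with find (recompute (adj? s t) st′)
  ... | d , d∈S , inj₁ t≡s+d = record
    { d∈S = d∈S ; joins = inj₁ (refl , refl) ; v≡u+d = t≡s+d
    ; page≡ = [ pageOf-forward n (≤3 d∈S)
              , (λ s+d≡t+n → contradiction s+d≡t+n
                  (<⇒≢ (+-mono-<-≤ (source<target′ e) (≤n d∈S))))
              ]′ (step-cases {{n≢0}} (Fin.toℕ<n s) (≤n d∈S) t≡s+d) }
  ... | d , d∈S , inj₂ s≡t+d = record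
    { d∈S = d∈S ; joins = inj₂ (refl , refl) ; v≡u+d = s≡t+d
    ; page≡ = [ (λ s≡t+d → contradiction (source<target′ e)
                  (≤⇒≯ (subst (toℕ t ≤_) (sym s≡t+d) (m≤m+n (toℕ t) d))))
              , pageOf-backward 6<n (≤3 d∈S)
              ]′ (step-cases {{n≢0}} (Fin.toℕ<n t) (≤n d∈S) s≡t+d) }

  -- The edge becomes an interval once the circle is cut at the origin of page `h`. Keeping `h`
  -- apart from `page e` lets two edges of equal page be unrolled over the same cut.
  record Unrolled (h : PageName) (e : Edge G) : Set where
    field
      {u v}   : Fin n
      {x y}   : ℕ
      joins   : Joins e u v
      u↑x     : Lift (origin h) u x
      v↑y     : Lift (origin h) v y
      x<y     : x < y
      centred : Centred (period h) (origin h) x y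

  unroll : ∀ {e h} → page e ≡ h → Unrolled h e
  unroll {e} refl with direct e
  ... | record { u = u ; v = v ; d∈S = d∈S ; joins = joins ; v≡u+d = v≡u+d ; page≡ = page≡ } =
    subst (λ h → Unrolled h e) (sym page≡) (build d∈S v≡u+d)
    where
    4∣n : 4 ∣ n
    4∣n = ∣-trans (divides 3 refl) 12∣n

    3∣n : 3 ∣ n
    3∣n = ∣-trans (divides 4 refl) 12∣n

    u≡c+0 : ∀ p .{{_ : NonZero p}} → toℕ u % p ≡ (toℕ (toℕ u mod p) + 0) % p
    u≡c+0 p = sym (trans ([m-mod-p+r]%p≡[m+r]%p (toℕ u) 0 p) (cong (_% p) (+-identityʳ (toℕ u))))

    pack : ∀ {d h} → 1 ≤ d →
           (∃₂ λ x y → Lift (origin h) u x × Lift (origin h) v y ×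
                       Centred (period h) (origin h) x y × y ≡ x + d) →
           Unrolled h e
    pack 1≤d (x , _ , u↑x , v↑y , centred , refl) = record
      { joins = joins ; u↑x = u↑x ; v↑y = v↑y ; x<y = m<m+n x 1≤d ; centred = centred }

    origin≤n : ∀ h → origin h ≤ n
    origin≤n h =
      ≤-trans (<⇒≤ (origin<period h)) (≤-trans (period≤4 h) (≤-trans (m≤m+n 4 2) (<⇒≤ 6<n)))

    build : ∀ {d} → d ∈ S → toℕ v ≡ (toℕ u + d) % n → Unrolled (pageOfStep d (toℕ u)) e
    -- Step 1 gives the inner edge of a block of four, whence `r = 1`; steps 2 and 3 span whole
    -- blocks of three and four, whence `r = 0`.
    build (here refl) v≡ = pack (≥1 (here refl))
      (step⇒centred {r = 1} 4∣n (Fin.toℕ<n c) (origin≤n (inj₁ c)) refl u≡c+1 v≡)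
      where
      c = (toℕ u + 3) mod 4

      u≡c+1 : toℕ u % 4 ≡ (toℕ c + 1) % 4
      u≡c+1 = sym (trans ([m-mod-p+r]%p≡[m+r]%p (toℕ u + 3) 1 4)
        (trans (cong (_% 4) (+-assoc (toℕ u) 3 1)) ([m+n]%n≡m%n (toℕ u) 4)))
    build (there (here refl)) v≡ = pack (≥1 (there (here refl)))
      (step⇒centred {r = 0} 3∣n (Fin.toℕ<n c) (origin≤n (inj₂ c)) refl (u≡c+0 3) v≡)
      where c = toℕ u mod 3
    build (there (there (here refl))) v≡ = pack (≥1 (there (there (here refl))))
      (step⇒centred {r = 0} 4∣n (Fin.toℕ<n c) (origin≤n (inj₁ c)) refl (u≡c+0 4) v≡)
      where c = toℕ u mod 4

  -- The alternative to laminarity is that the intervals coincide; then the endpoints coincide too,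
  -- and so do the edges.
  same-page⇒laminar : ∀ {e f} → e ≢ f → (E : Unrolled (page e) e) (F : Unrolled (page e) f) →
    Laminar (Unrolled.x E) (Unrolled.y E) (Unrolled.x F) (Unrolled.y F)
  same-page⇒laminar e≢f E F with centred⇒laminar (Unrolled.centred E) (Unrolled.centred F)
  ... | inj₂ laminar = laminar
  ... | inj₁ (x≡ , y≡) with lift-injective (Unrolled.u↑x E) (Unrolled.u↑x F) x≡
                          | lift-injective (Unrolled.v↑y E) (Unrolled.v↑y F) y≡
  ...   | refl | refl = contradiction (joins-unique (Unrolled.joins E) (Unrolled.joins F)) e≢f

  module _ {e f : Edge G} (e≢f : e ≢ f) (same : page e ≡ page f) where

    private
      E : Unrolled (page e) e
      E = unroll refl

      F : Unrolled (page e) f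
      F = unroll (sym same)

      module E = Unrolled E
      module F = Unrolled F

      laminar : Laminar E.x E.y F.x F.y
      laminar = same-page⇒laminar e≢f E F

      lift-≡ : ∀ {w w′ : Fin n} {z z′} →
               Lift (origin (page e)) w z → Lift (origin (page e)) w′ z′ → w ≡ w′ → z ≡ z′
      lift-≡ l l′ refl = lift-functional l l′

    same-page⇒¬share : ¬ ShareEndpoint e f
    same-page⇒¬share share = laminar⇒disjoint E.x<y F.x<y laminar
      (Sum.map (Sum.map (lift-≡ E.u↑x F.u↑x) (lift-≡ E.u↑x F.v↑y))
               (Sum.map (lift-≡ E.v↑y F.u↑x) (lift-≡ E.v↑y F.v↑y))
        (share⇒joins {e = e} {f} E.joins F.joins share))

    same-page⇒¬cross : ¬ Crosses Perm.id e f
    same-page⇒¬cross cross = laminar⇒uncrossed E.x<y F.x<y laminar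
      (Sum.map
        (λ (p , q) → cyclic⇒cyclicᴺ E.u↑x F.u↑x E.v↑y p , cyclic⇒cyclicᴺ E.v↑y F.v↑y E.u↑x q)
        (λ (p , q) → cyclic⇒cyclicᴺ E.u↑x F.v↑y E.v↑y p , cyclic⇒cyclicᴺ E.v↑y F.u↑x E.u↑x q)
        (crosses⇒chordsCross Perm.id {e} {f} E.joins F.joins cross))

  edgeOfStep : ∀ {d} → d ∈ S → ∀ i → i + d < n → ∃ λ e → page e ≡ pageOfStep d i
  edgeOfStep {d} d∈S i i+d<n = edge s t s<t (lose d∈S (inj₁ t≡s+d)) , page≡
    where
    i<n = ≤-<-trans (m≤m+n i d) i+d<n
    s = fromℕ< i<n
    t = fromℕ< i+d<n

    s≡i : toℕ s ≡ i
    s≡i = Fin.toℕ-fromℕ< i<n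

    t≡ : toℕ t ≡ toℕ s + d
    t≡ = trans (Fin.toℕ-fromℕ< i+d<n) (cong (_+ d) (sym s≡i))

    s<t : s Fin.< t
    s<t = subst (toℕ s <_) (sym t≡) (m<m+n (toℕ s) (≥1 d∈S))

    t≡s+d : toℕ t ≡ (toℕ s + d) % n
    t≡s+d = trans (sym (m<n⇒m%n≡m (Fin.toℕ<n t))) (cong (_% n) t≡)

    page≡ = trans (pageOf-forward n (≤3 d∈S) t≡) (cong (pageOfStep d) s≡i)

  -- The witnesses are `{c , c+3}` for `inj₁ c` and `{c , c+2}` for `inj₂ c`. They do not wrap,
  -- since their larger ends are at most 6 and `6 < n`.
  page-surjective : ∀ h → ∃ λ e → page e ≡ h
  page-surjective (inj₁ c) = proj₁ found , trans (proj₂ found) (cong inj₁ (mod-toℕ c))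
    where
    found = edgeOfStep (there (there (here refl))) (toℕ c)
      (≤-<-trans (+-monoˡ-≤ 3 (m<1+n⇒m≤n (Fin.toℕ<n c))) 6<n)
  page-surjective (inj₂ c) = proj₁ found , trans (proj₂ found) (cong inj₂ (mod-toℕ c))
    where
    found = edgeOfStep (there (here refl)) (toℕ c)
      (<-trans (+-monoˡ-< 2 (Fin.toℕ<n c)) (<-trans ≤-refl 6<n))

  colour : Edge G → Fin 7
  colour = join 4 3 ∘ page

  same-colour⇒same-page : ∀ {e f} → colour e ≡ colour f → page e ≡ page f
  same-colour⇒same-page {e} {f} eq = trans (sym (Fin.splitAt-join 4 3 (page e)))
    (trans (cong (splitAt 4) eq) (Fin.splitAt-join 4 3 (page f)))

  embedding : MatchingBookEmbedding G 7
  embedding = record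
    { order             = Perm.id
    ; colour            = colour
    ; colour-surjective = λ p → let (e , page≡) = page-surjective (splitAt 4 p) in
        e , λ { refl → trans (cong (join 4 3) page≡) (Fin.join-splitAt 4 3 p) }
    ; noncrossing       = λ e f e≢f same → same-page⇒¬cross e≢f (same-colour⇒same-page {e} {f} same)
    ; matching          = λ e f e≢f same → same-page⇒¬share e≢f (same-colour⇒same-page {e} {f} same)
    }

theorem9 : (m : ℕ) (m≥1 : m ≥ 1) →
    NearlyDispersable (circulant (12 * m) (1 ∷ 2 ∷ 3 ∷ []) (isConnectionSet₁₂₃ (6≤12*m m≥1)))
theorem9 m m≥1 = circulant₁₂₃-¬dispersable isS 6<n ,
  -- Seven pages are `1 + maxDegree G` because the graph is 6-regular.
  subst (λ k → MatchingBookEmbedding G (1 + k))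
    (sym (regular⇒maxDegree G (fromℕ< 6<n) (circulant₁₂₃-regular isS 6<n)))
    (Embedding.embedding isS 6<n (m∣m*n m))
  where
  isS = isConnectionSet₁₂₃ (6≤12*m m≥1)

  G = circulant (12 * m) _ isS

  6<n : 6 < 12 * m
  6<n = ≤-trans (m≤m+n 7 5) (*-monoʳ-≤ 12 m≥1)
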